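{- Let $m\geq 2$ be an integer and let $X=\{X(j)\}_{j\geq 1}$ be a modulo-$m$ Toeplitz fixed point over a finite alphabet $\mathcal A$ which is not a constant word. Let $q\geq 2$ be an integer such that $m\nmid q$ and $q\mid m^s$ for some integer $s\geq 1$. Let $X(q\mathbb N)$ denote the sequence $\{X(qj)\}_{j\geq 1}$. Then the following hold: (i) If $q\nmid m^2$, then $X(q\mathbb N)$ is not a modulo-$m$ Toeplitz fixed point. (ii) If $q\mid m$, then $X(q\mathbb N)$ is a modulo-$m$ Toeplitz fixed point if and only if the finite word $X(1)\dots X(m)$ is almost $q$-periodic. (iii) If $q\mid m^2$, then $X(q\mathbb N)$ is a modulo-$m$ Toeplitz fixed point if and only if the finite word $X(1)\dots X(m^2)$ is almost $q$-periodic.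
   Context: Let $\mathcal A$ be a finite set (alphabet). All words and sequences are indexed starting from $1$, and $\mathbb N=\{1,2,3,\dots\}$. Modulo-$m$ Toeplitz fixed point: let $m\geq 2$ and let $W=w_1\dots w_{m-1}$ be a word of length $m-1$ over $\mathcal A$. The Toeplitz substitution determined by $W$ is the morphism $\sigma$ on finite and infinite words over $\mathcal A$ with $\sigma(a)=Wa$ (concatenation) for every letter $a\in\mathcal A$. The infinite word $X=\lim_{k\to\infty}\sigma^k(w_1)$ (each $\sigma^k(w_1)$ is a prefix of $\sigma^{k+1}(w_1)$) is called the fixed point of $\sigma$. An infinite word over $\mathcal A$ is a modulo-$m$ Toeplitz fixed point if it arises in this way from some word $W$ of length $m-1$ over $\mathcal A$. Almost $q$-periodic: a finite word $w_1\dots w_n$ with $2\leq q<n$ is almost $q$-periodic if $w_j=w_{j+q}$ for all $1\leq j\leq n-q$ with $q\nmid j$. -}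

module Defs where

open import Data.Fin.Base using (Fin; toℕ)
open import Data.List.Base using (List; []; _∷_; [_]; _++_; concatMap; take)
open import Data.List.NonEmpty.Base as List⁺ using (List⁺)
open import Data.Nat.Base using (ℕ; zero; suc; _+_; _*_; _∸_; _≤_; _<_; NonZero)
open import Data.Nat.Divisibility using (_∣_)
open import Data.Nat.Properties using (m*n≢0)
open import Data.Product.Base using (∃; ∃-syntax; _×_)
open import Data.Vec.Base using (Vec; tabulate; lookup; toList)
open import Function.Base using (_∘_)
open import Function.Bundles using (_↔_)
open import Level using (Level)
open import Relation.Binary.PropositionalEquality.Core using (_≡_)
open import Relation.Nullary.Negation.Core using (¬_)

private
  variable
    a : Level
    A : Set a

Finite : Set a → Set a
Finite A = ∃[ n ] (A ↔ Fin n)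

-- Positions are the positive integers.
InfWord : Set a → Set a
InfWord A = (j : ℕ) → .{{NonZero j}} → A

-- The finite word X(1) … X(n); entry i : Fin n is the letter X(i + 1).
prefix : (n : ℕ) → InfWord A → Vec A n
prefix n X = tabulate (λ i → X (suc (toℕ i)))

Constant : InfWord A → Set _
Constant {A = A} X = ∃[ c ] ((j : ℕ) .{{_ : NonZero j}} → X j ≡ c)

-- The sequence X(qℕ).
multiples : (q : ℕ) .{{_ : NonZero q}} → InfWord A → InfWord A
multiples q X j = X (q * j) {{m*n≢0 q j}}

σ : List⁺ A → List A → List A
σ W = concatMap (λ c → List⁺.toList W ++ [ c ])

σ^ : List⁺ A → ℕ → List A → List A
σ^ W zero    u = u
σ^ W (suc k) u = σ W (σ^ W k u)

-- Convergence of finite words to an infinite one: for every n, the words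
-- u k with k large enough have length at least n and begin with X(1) … X(n).
_⟶_ : (ℕ → List A) → InfWord A → Set _
u ⟶ X = ∀ n → ∃[ K ] (∀ k → K ≤ k → take n (u k) ≡ toList (prefix n X))

-- W is nonempty, so that w₁ exists; for m ≥ 2 this is automatic from its
-- length.
IsToeplitzFixedPoint : ℕ → InfWord A → Set _
IsToeplitzFixedPoint m X =
  ∃[ W ] (List⁺.length W ≡ m ∸ 1 × (λ k → σ^ W k [ List⁺.head W ]) ⟶ X)

-- Entries are numbered from 0 by Fin n, so entry i is the letter in position
-- j = i + 1; a pair i, i′ with i′ = i + q is the same as a j with
-- 1 ≤ j ≤ n - q.
AlmostPeriodic : ℕ → {n : ℕ} → Vec A n → Set _
AlmostPeriodic q {n} w =
  2 ≤ q × q < n ×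
  (∀ (i i′ : Fin n) → toℕ i′ ≡ toℕ i + q → ¬ (q ∣ suc (toℕ i)) →
   lookup w i ≡ lookup w i′)

{-# OPTIONS --safe #-}
-- Extend X to a total x : ℕ → A.  Being a modulo-m Toeplitz fixed point means
-- that x (j + m) = x j off the multiples of m, and x (m j) = x j.  The sequence
-- y j = x (q j) inherits the second property, so only the m-periodicity of y
-- off the multiples of m matters.  Write m = d g and q = e g with g = gcd m q.
-- Then y is so periodic iff x (n + q) = x n whenever e ∣ n and q ∤ n.  If
-- e ∤ r, let k be minimal with e ∣ m ^ k r.  Then q ∤ m ^ k r because d and e
-- are coprime, and k ≥ 1, so that x r = x (m ^ k r) = x (m ^ k r + q) = x q by
-- periodicity, as m ∤ q.  So x is constant off the multiples of e, and x is
-- almost q-periodic.  If moreover q ∤ m², then e ∤ m, so each r with e ∣ r and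
-- m ∤ r has x r = x (r + m) = x q, and x is constant.
module Submission where

open import Data.Fin.Base using (toℕ; fromℕ<)
open import Data.Fin.Properties using (toℕ-fromℕ<)
open import Data.List.Base using (List; []; _∷_; [_]; _++_; take; drop; head; length; applyUpTo)
open import Data.List.NonEmpty.Base as List⁺ using (List⁺; _∷_)
open import Data.List.Properties using (length-++; length-applyUpTo; ∷-injective)
open import Data.Maybe.Base using (Maybe; just)
open import Data.Maybe.Properties using (just-injective)
open import Data.Nat.Base using (ℕ; zero; suc; _+_; _*_; _≤_; _<_; _^_; NonZero; z≤n; s≤s; z<s; s<s; >-nonZero; ≢-nonZero)
open import Data.Nat.Coprimality as Coprimality using (Coprime; coprime-divisor; coprime-/gcd)
open import Data.Nat.Divisibility
open import Data.Nat.DivMod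
open import Data.Nat.GCD using (gcd; gcd[m,n]∣m; gcd[m,n]∣n; gcd[m,n]≢0)
open import Data.Nat.Induction using (<-rec)
open import Data.Nat.Properties
open import Data.Nat.Tactic.RingSolver using (solve-∀)
open import Data.Product.Base using (∃-syntax; _×_; _,_; proj₁; proj₂)
open import Data.Sum.Base using (inj₁; inj₂)
open import Data.Vec.Base using (tabulate; lookup; toList)
open import Data.Vec.Properties using (lookup∘tabulate)
open import Function.Base using (_∘_)
open import Function.Bundles using (_⇔_; mk⇔; module Equivalence)
open import Function.Construct.Composition using (_⇔-∘_)
open import Level using (Level)
open import Relation.Binary.PropositionalEquality using (_≡_; _≢_; refl; sym; trans; cong; cong₂; subst; subst₂; module ≡-Reasoning)
open import Relation.Nullary.Decidable.Core using (yes; no)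
open import Relation.Nullary.Negation.Core using (¬_; contradiction)
open import Defs

private
  variable
    a : Level
    A : Set a

-- Almost periodic and Toeplitz sequences on the naturals.

AlmostPeriodic∞ : ℕ → (ℕ → A) → Set _
AlmostPeriodic∞ q x = ∀ n → ¬ q ∣ n → x (n + q) ≡ x n

record Toeplitz {A : Set a} (m : ℕ) (x : ℕ → A) : Set a where
  field
    almostPeriodic : AlmostPeriodic∞ m x
    selfSimilar    : ∀ j → x (m * j) ≡ x j

open Toeplitz

∤⇒∤+ : ∀ {q n} → ¬ q ∣ n → ¬ q ∣ n + q
∤⇒∤+ {q} {n} q∤n q∣n+q = q∤n (∣m+n∣m⇒∣n (subst (q ∣_) (+-comm n q) q∣n+q) ∣-refl)

shift : ∀ {q} {x : ℕ → A} → AlmostPeriodic∞ q x →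
        ∀ k {n} → ¬ q ∣ n → x (n + k * q) ≡ x n
shift {x = x}         ap zero    {n} q∤n = cong x (+-identityʳ n)
shift {q = q} {x = x} ap (suc k) {n} q∤n = begin
  x (n + (q + k * q)) ≡⟨ cong x (+-assoc n q (k * q)) ⟨
  x (n + q + k * q)   ≡⟨ shift ap k (∤⇒∤+ q∤n) ⟩
  x (n + q)           ≡⟨ ap n q∤n ⟩
  x n                 ∎
  where open ≡-Reasoning

residue : ∀ {q} .{{_ : NonZero q}} {x : ℕ → A} → AlmostPeriodic∞ q x →
          ∀ {n} → ¬ q ∣ n → x n ≡ x (n % q)
residue {q = q} {x} ap {n} q∤n = begin
  x n                     ≡⟨ cong x (m≡m%n+[m/n]*n n q) ⟩
  x (n % q + n / q * q)   ≡⟨ shift ap (n / q) (q∤n ∘ ∣n∣m%n⇒∣m ∣-refl) ⟩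
  x (n % q)               ∎
  where open ≡-Reasoning

selfSimilarʳ : ∀ {m} {x : ℕ → A} → Toeplitz m x → ∀ j → x (j * m) ≡ x j
selfSimilarʳ {m = m} {x} t j = trans (cong x (*-comm j m)) (selfSimilar t j)

-- This reduces the case `q ∣ m ^ 2` to that of a `q` dividing the modulus. Off the multiples of
-- `m`, a shift by `m * m` is `m` shifts by `m`; at `i * m`, self-similarity contracts it to a
-- single shift by `m` at `i`.
toeplitz-square : ∀ {m} {x : ℕ → A} → Toeplitz m x → Toeplitz (m * m) x
toeplitz-square {m = m} {x} t = record
  { almostPeriodic = ap
  ; selfSimilar    = λ j → begin
      x (m * m * j)   ≡⟨ cong x (*-assoc m m j) ⟩
      x (m * (m * j)) ≡⟨ selfSimilar t (m * j) ⟩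
      x (m * j)       ≡⟨ selfSimilar t j ⟩
      x j             ∎
  }
  where
  open ≡-Reasoning
  ap : AlmostPeriodic∞ (m * m) x
  ap n m²∤n with m ∣? n
  ... | no m∤n = shift (almostPeriodic t) m m∤n
  ... | yes (divides-refl i) = begin
    x (i * m + m * m)   ≡⟨ cong x (*-distribʳ-+ m i m) ⟨
    x ((i + m) * m)     ≡⟨ selfSimilarʳ t (i + m) ⟩
    x (i + m)           ≡⟨ almostPeriodic t i (m²∤n ∘ *-monoˡ-∣ m) ⟩
    x i                 ≡⟨ selfSimilarʳ t i ⟨
    x (i * m)           ∎

-- `M`-periodicity moves any position into the window up to `M`, and steps of `q` inside the window
-- lead down to the residue mod `q`. As `q ∣ M`, that residue is the one of the original position,
-- so `n` and `n + q` end at the same place.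
extend-almostPeriodic :
  ∀ {M q} .{{_ : NonZero M}} .{{_ : NonZero q}} {x : ℕ → A} →
  AlmostPeriodic∞ M x → q ∣ M →
  (∀ n → n + q ≤ M → ¬ q ∣ n → x (n + q) ≡ x n) →
  AlmostPeriodic∞ q x
extend-almostPeriodic {M = M} {q} {x} apM q∣M fin n q∤n = begin
  x (n + q)         ≡⟨ reduce (∤⇒∤+ q∤n) ⟩
  x ((n + q) % q)   ≡⟨ cong x ([m+n]%n≡m%n n q) ⟩
  x (n % q)         ≡⟨ reduce q∤n ⟨
  x n               ∎
  where
  open ≡-Reasoning

  chain : ∀ k {r} → ¬ q ∣ r → r + k * q ≤ M → x (r + k * q) ≡ x r
  chain zero    {r} q∤r _  = cong x (+-identityʳ r)
  chain (suc k) {r} q∤r le = begin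
    x (r + (q + k * q)) ≡⟨ cong x (+-assoc r q (k * q)) ⟨
    x (r + q + k * q)   ≡⟨ chain k (∤⇒∤+ q∤r) le′ ⟩
    x (r + q)           ≡⟨ fin r (≤-trans (m≤m+n (r + q) (k * q)) le′) q∤r ⟩
    x r                 ∎
    where
    le′ : r + q + k * q ≤ M
    le′ = subst (_≤ M) (sym (+-assoc r q (k * q))) le

  reduce : ∀ {n} → ¬ q ∣ n → x n ≡ x (n % q)
  reduce {n} q∤n = begin
    x n                     ≡⟨ residue apM (q∤n ∘ ∣-trans q∣M) ⟩
    x r                     ≡⟨ cong x r≡ ⟩
    x (r % q + r / q * q)   ≡⟨ chain (r / q) q∤r%q (subst (_≤ M) r≡ (m%n≤n n M)) ⟩
    x (r % q)               ≡⟨ cong x (m∣n⇒o%n%m≡o%m q M n q∣M) ⟩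
    x (n % q)               ∎
    where
    r = n % M
    r≡ = m≡m%n+[m/n]*n r q
    q∤r%q : ¬ q ∣ r % q
    q∤r%q q∣r%q = q∤n (∣n∣m%n⇒∣m q∣M (∣n∣m%n⇒∣m ∣-refl q∣r%q))

-- A shift of `j` by `m` moves `q * j` by `q * m`. This is `q` shifts by `m` if `m ∤ q * j`; if
-- `q * j = n * m`, contracting by `m` leaves one shift by `q` at `n`.
multiples-almostPeriodic :
  ∀ {m q} .{{_ : NonZero q}} {x : ℕ → A} → Toeplitz m x →
  AlmostPeriodic∞ q x → AlmostPeriodic∞ m (λ j → x (q * j))
multiples-almostPeriodic {m = m} {q} {x} t apq j m∤j with m ∣? q * j
... | no m∤qj = begin
  x (q * (j + m))     ≡⟨ cong x (*-distribˡ-+ q j m) ⟩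
  x (q * j + q * m)   ≡⟨ shift (almostPeriodic t) q m∤qj ⟩
  x (q * j)           ∎
  where open ≡-Reasoning
... | yes (divides n qj≡nm) = begin
  x (q * (j + m))   ≡⟨ cong x (*-distribˡ-+ q j m) ⟩
  x (q * j + q * m) ≡⟨ cong (λ k → x (k + q * m)) qj≡nm ⟩
  x (n * m + q * m) ≡⟨ cong x (*-distribʳ-+ m n q) ⟨
  x ((n + q) * m)   ≡⟨ selfSimilarʳ t (n + q) ⟩
  x (n + q)         ≡⟨ apq n q∤n ⟩
  x n               ≡⟨ selfSimilarʳ t n ⟨
  x (n * m)         ≡⟨ cong x qj≡nm ⟨
  x (q * j)         ∎
  where
  open ≡-Reasoning
  q∤n : ¬ q ∣ n
  q∤n q∣n = m∤j (*-cancelˡ-∣ q (subst (q * m ∣_) (sym qj≡nm) (*-monoˡ-∣ m q∣n)))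

-- Recovering `x` from its subsequence of multiples of `q`.

module _ {m q d e g : ℕ} .{{_ : NonZero d}} .{{_ : NonZero g}}
         (m≡dg : m ≡ d * g) (q≡eg : q ≡ e * g) (e⊥d : Coprime e d)
         {x : ℕ → A} (t : Toeplitz m x) (m∤q : ¬ m ∣ q)
         (s : ℕ) (q∣mˢ : q ∣ m ^ s)
         (ap : AlmostPeriodic∞ m (λ j → x (q * j)))
  where
  private
    e∣q : e ∣ q
    e∣q = subst (e ∣_) (sym q≡eg) (m∣m*n g)

    q∣mr⇒e∣r : ∀ {r} → q ∣ m * r → e ∣ r
    q∣mr⇒e∣r {r} q∣mr = coprime-divisor e⊥d (*-cancelʳ-∣ g (subst₂ _∣_ q≡eg mr≡ q∣mr))
      where
      swapʳ : ∀ d g r → d * g * r ≡ d * r * g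
      swapʳ = solve-∀
      mr≡ : m * r ≡ d * r * g
      mr≡ = trans (cong (_* r) m≡dg) (swapʳ d g r)

    -- Multiplying a multiple of `e` by `m = d * g` gives a multiple of `q = e * g`, where the
    -- periodicity of the subsequence applies; self-similarity then divides the shift `m * q` by
    -- `m`.
    periodic-on-e : ∀ {n} → e ∣ n → ¬ q ∣ n → x (n + q) ≡ x n
    periodic-on-e (divides-refl i) q∤n = begin
      x (n + q)               ≡⟨ selfSimilar t (n + q) ⟨
      x (m * (n + q))         ≡⟨ cong x (*-distribˡ-+ m n q) ⟩
      x (m * n + m * q)       ≡⟨ cong₂ (λ k l → x (k + l)) mn≡ (*-comm m q) ⟩
      x (q * (d * i) + q * m) ≡⟨ cong x (*-distribˡ-+ q (d * i) m) ⟨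
      x (q * (d * i + m))     ≡⟨ ap (d * i) m∤di ⟩
      x (q * (d * i))         ≡⟨ cong x mn≡ ⟨
      x (m * n)               ≡⟨ selfSimilar t n ⟩
      x n                     ∎
      where
      open ≡-Reasoning
      n = i * e
      exchange : ∀ d g i e → d * g * (i * e) ≡ e * g * (d * i)
      exchange = solve-∀
      mn≡ : m * n ≡ q * (d * i)
      mn≡ = trans (cong (_* n) m≡dg) (trans (exchange d g i e) (cong (_* (d * i)) (sym q≡eg)))
      m∤di : ¬ m ∣ d * i
      m∤di m∣di = q∤n (subst₂ _∣_ (sym q≡eg) (*-comm e i)
        (*-monoʳ-∣ e (*-cancelˡ-∣ d (subst (_∣ d * i) m≡dg m∣di))))

    constant-on-preimage : ∀ {r} → e ∣ m * r → ¬ e ∣ r → x r ≡ x q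
    constant-on-preimage {r} e∣mr e∤r = begin
      x r             ≡⟨ selfSimilar t r ⟨
      x (m * r)       ≡⟨ periodic-on-e e∣mr (e∤r ∘ q∣mr⇒e∣r) ⟨
      -- The roles swap here: `q` is now the base point, shifted `r` times by `m`, so the result
      -- does not depend on `r`.
      x (m * r + q)   ≡⟨ cong x (trans (+-comm (m * r) q) (cong (q +_) (*-comm m r))) ⟩
      x (q + r * m)   ≡⟨ shift (almostPeriodic t) r m∤q ⟩
      x q             ∎
      where open ≡-Reasoning

    -- All of `r`, `m * r`, `m ^ 2 * r`, ... carry the same letter, so `r` may be replaced by the
    -- last of them that `e` does not divide.
    constant-below : ∀ k {r} → e ∣ m ^ k * r → ¬ e ∣ r → x r ≡ x q
    constant-below zero    {r} e∣ e∤r = contradiction (subst (e ∣_) (*-identityˡ r) e∣) e∤r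
    constant-below (suc k) {r} e∣ e∤r with e ∣? m * r
    ... | yes e∣mr = constant-on-preimage e∣mr e∤r
    ... | no  e∤mr = trans (sym (selfSimilar t r)) (constant-below k (subst (e ∣_) eq e∣) e∤mr)
      where
      eq : m * m ^ k * r ≡ m ^ k * (m * r)
      eq = trans (cong (_* r) (*-comm m (m ^ k))) (*-assoc (m ^ k) m r)

  constant-off-e : ∀ {r} → ¬ e ∣ r → x r ≡ x q
  constant-off-e = constant-below s (∣m⇒∣m*n _ (∣-trans e∣q q∣mˢ))

  almostPeriodic-of-multiples : AlmostPeriodic∞ q x
  almostPeriodic-of-multiples n q∤n with e ∣? n
  ... | yes e∣n = periodic-on-e e∣n q∤n
  ... | no  e∤n = trans (constant-off-e e∤n+q) (sym (constant-off-e e∤n))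
    where
    e∤n+q : ¬ e ∣ n + q
    e∤n+q e∣n+q = e∤n (∣m+n∣m⇒∣n (subst (e ∣_) (+-comm n q) e∣n+q) e∣q)

  constant-of-multiples : 2 ≤ m → ¬ q ∣ m * m → ∀ j → .{{_ : NonZero j}} → x j ≡ x q
  constant-of-multiples 2≤m q∤m² = <-rec _ step
    where
    -- Since `g ∣ m`, having `e ∣ m` as well would give `q = e * g ∣ m * m`.
    e∤m : ¬ e ∣ m
    e∤m e∣m = q∤m² (subst (_∣ m * m) (sym q≡eg)
      (*-pres-∣ e∣m (subst (g ∣_) (sym m≡dg) (n∣m*n d))))

    step : ∀ j → (∀ {i} → i < j → .{{_ : NonZero i}} → x i ≡ x q) → .{{_ : NonZero j}} → x j ≡ x q
    step j rec with e ∣? j | m ∣? j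
    ... | no e∤j  | _ = constant-off-e e∤j
    ... | yes e∣j | no m∤j = trans (sym (almostPeriodic t j m∤j))
      (constant-off-e (λ e∣j+m → e∤m (∣m+n∣m⇒∣n e∣j+m e∣j)))
    -- Descent: `j = i * m` is positive and `m ≥ 2`, so `i` is positive and smaller than `j`.
    ... | yes _   | yes (divides-refl i) = trans (selfSimilarʳ t i) (rec i<im {{i≢0}})
      where
      i≢0 : NonZero i
      i≢0 = m*n≢0⇒m≢0 i
      i<im : i < i * m
      i<im = m<m*n i m {{i≢0}} 2≤m

-- Letters of finite words and of their images under `σ`.

_‼_ : List A → ℕ → Maybe A
u ‼ i = head (drop i u)

‼-++ˡ : ∀ (u : List A) {v i} → i < length u → (u ++ v) ‼ i ≡ u ‼ i
‼-++ˡ (c ∷ u) {i = zero}  _         = refl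
‼-++ˡ (c ∷ u) {i = suc i} (s<s i<n) = ‼-++ˡ u i<n

‼-++ʳ : ∀ (u : List A) {v} i → (u ++ v) ‼ (length u + i) ≡ v ‼ i
‼-++ʳ []      i = refl
‼-++ʳ (c ∷ u) i = ‼-++ʳ u i

‼-applyUpTo : ∀ (f : ℕ → A) {n i} → i < n → applyUpTo f n ‼ i ≡ just (f i)
‼-applyUpTo f {suc n} {zero}  _         = refl
‼-applyUpTo f {suc n} {suc i} (s<s i<n) = ‼-applyUpTo (f ∘ suc) i<n

-- An equation with `just` also says that the position exists, so the letterwise form needs no
-- separate bound on the length of `u`.
take≡tabulate⇔ : ∀ n (f : ℕ → A) u →
  take n u ≡ toList (tabulate {n = n} (f ∘ toℕ)) ⇔ (∀ {i} → i < n → u ‼ i ≡ just (f i))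
take≡tabulate⇔ n f u = mk⇔ (to n f u) (from n f u)
  where
  to : ∀ n (f : ℕ → A) u → take n u ≡ toList (tabulate {n = n} (f ∘ toℕ)) →
       ∀ {i} → i < n → u ‼ i ≡ just (f i)
  to (suc n) f (c ∷ u) eq {zero}  _         = cong just (proj₁ (∷-injective eq))
  to (suc n) f (c ∷ u) eq {suc i} (s<s i<n) = to n (f ∘ suc) u (proj₂ (∷-injective eq)) i<n

  from : ∀ n (f : ℕ → A) u → (∀ {i} → i < n → u ‼ i ≡ just (f i)) →
         take n u ≡ toList (tabulate {n = n} (f ∘ toℕ))
  from zero    f u       eq = refl
  from (suc n) f []      eq = contradiction (eq z<s) λ ()
  from (suc n) f (c ∷ u) eq =
    cong₂ _∷_ (just-injective (eq z<s)) (from n (f ∘ suc) u (λ i<n → eq (s<s i<n)))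

length-block : ∀ (W : List⁺ A) c → length (List⁺.toList W ++ [ c ]) ≡ suc (List⁺.length W)
length-block W c = trans (length-++ (List⁺.toList W)) (+-comm (List⁺.length W) 1)

-- All blocks have the same length, so the image of letter `p`, counted from 0, starts at `p` times
-- that length.
‼-σ : ∀ (W : List⁺ A) u {p i c} → u ‼ p ≡ just c → i < suc (List⁺.length W) →
      σ W u ‼ (p * suc (List⁺.length W) + i) ≡ (List⁺.toList W ++ [ c ]) ‼ i
‼-σ W (b ∷ u) {zero}  {i} refl i<m =
  ‼-++ˡ (List⁺.toList W ++ [ b ]) (subst (i <_) (sym (length-block W b)) i<m)
‼-σ W (b ∷ u) {suc p} {i} {c} eq i<m = begin
  σ W (b ∷ u) ‼ (m + p * m + i)                  ≡⟨ cong (σ W (b ∷ u) ‼_) (+-assoc m (p * m) i) ⟩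
  (B ++ σ W u) ‼ (m + (p * m + i))               ≡⟨ cong (λ k → (B ++ σ W u) ‼ (k + (p * m + i))) (length-block W b) ⟨
  (B ++ σ W u) ‼ (length B + (p * m + i))        ≡⟨ ‼-++ʳ B (p * m + i) ⟩
  σ W u ‼ (p * m + i)                            ≡⟨ ‼-σ W u {p} eq i<m ⟩
  (List⁺.toList W ++ [ c ]) ‼ i                  ∎
  where
  open ≡-Reasoning
  m = suc (List⁺.length W)
  B = List⁺.toList W ++ [ b ]

-- The block of x in positions p m + 1, …, p m + m, where m is the length of W
-- plus one, is W followed by the letter in position p + 1.
Blocks : List⁺ A → (ℕ → A) → Set _
Blocks W x = ∀ p {i} → i < suc (List⁺.length W) →
  (List⁺.toList W ++ [ x (suc p) ]) ‼ i ≡ just (x (suc (p * suc (List⁺.length W) + i)))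

-- All blocks share their letters except the last one, which gives the periodicity; the last letter
-- of block `p` sits at position `m * suc p` and gives self-similarity.
blocks⇒toeplitz : ∀ (W : List⁺ A) {x} → Blocks W x → Toeplitz (suc (List⁺.length W)) x
blocks⇒toeplitz W {x} blocks = record { almostPeriodic = ap ; selfSimilar = self }
  where
  open ≡-Reasoning
  l = List⁺.length W
  m = suc l
  w = List⁺.toList W

  letter : ∀ p {i} → i < l → w ‼ i ≡ just (x (suc (p * m + i)))
  letter p i<l = trans (sym (‼-++ˡ w i<l)) (blocks p (m<n⇒m<1+n i<l))

  ap : AlmostPeriodic∞ m x
  ap zero    m∤0 = contradiction (m ∣0) m∤0
  ap (suc j) m∤j = begin
    x (suc (j + m))                 ≡⟨ cong (x ∘ suc) j+m≡ ⟩
    x (suc (suc (j / m) * m + r))   ≡⟨ just-injective (trans (sym (letter (suc (j / m)) r<l)) (letter (j / m) r<l)) ⟩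
    x (suc (j / m * m + r))         ≡⟨ cong (x ∘ suc) j≡ ⟨
    x (suc j)                       ∎
    where
    r = j % m
    j≡ : j ≡ j / m * m + r
    j≡ = trans (m≡m%n+[m/n]*n j m) (+-comm r _)
    j+m≡ : j + m ≡ suc (j / m) * m + r
    j+m≡ = trans (+-comm j m) (trans (cong (m +_) j≡) (sym (+-assoc m (j / m * m) r)))
    -- Offsets count from 0 and positions from 1, so the last offset `l` belongs to the multiples of
    -- `m`.
    r≢l : r ≢ l
    r≢l r≡l = m∤j (divides (suc (j / m)) (cong suc (begin
      j                 ≡⟨ m≡m%n+[m/n]*n j m ⟩
      r + j / m * m     ≡⟨ cong (_+ j / m * m) r≡l ⟩
      l + j / m * m     ∎)))
    r<l : r < l
    r<l = ≤∧≢⇒< (m<1+n⇒m≤n (m%n<n j m)) r≢l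

  self : ∀ j → x (m * j) ≡ x j
  self zero    = cong x (*-zeroʳ m)
  self (suc p) = sym (just-injective (begin
    just (x (suc p))                        ≡⟨ ‼-++ʳ w 0 ⟨
    (w ++ [ x (suc p) ]) ‼ (l + 0)          ≡⟨ cong ((w ++ [ x (suc p) ]) ‼_) (+-identityʳ l) ⟩
    (w ++ [ x (suc p) ]) ‼ l                ≡⟨ blocks p (n<1+n l) ⟩
    just (x (suc (p * m + l)))              ≡⟨ cong (just ∘ x) (trans (cong suc (+-comm (p * m) l)) (*-comm (suc p) m)) ⟩
    just (x (m * suc p))                    ∎))

toeplitz⇒blocks : ∀ (W : List⁺ A) {x} → List⁺.toList W ≡ applyUpTo (x ∘ suc) (List⁺.length W) →
                  Toeplitz (suc (List⁺.length W)) x → Blocks W x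
toeplitz⇒blocks W {x} W≡ t p {i} i<m with m<1+n⇒m<n∨m≡n i<m
... | inj₁ i<l = begin
  (w ++ [ x (suc p) ]) ‼ i        ≡⟨ ‼-++ˡ w i<l ⟩
  w ‼ i                           ≡⟨ cong (_‼ i) W≡ ⟩
  applyUpTo (x ∘ suc) l ‼ i       ≡⟨ ‼-applyUpTo (x ∘ suc) i<l ⟩
  just (x (suc i))                ≡⟨ cong just (shift (almostPeriodic t) p (>⇒∤ (s<s i<l))) ⟨
  just (x (suc (i + p * m)))      ≡⟨ cong (just ∘ x ∘ suc) (+-comm i (p * m)) ⟩
  just (x (suc (p * m + i)))      ∎
  where
  open ≡-Reasoning
  l = List⁺.length W
  m = suc l
  w = List⁺.toList W
... | inj₂ refl = begin
  (w ++ [ x (suc p) ]) ‼ l        ≡⟨ cong ((w ++ [ x (suc p) ]) ‼_) (+-identityʳ l) ⟨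
  (w ++ [ x (suc p) ]) ‼ (l + 0)  ≡⟨ ‼-++ʳ w 0 ⟩
  just (x (suc p))                ≡⟨ cong just (selfSimilarʳ t (suc p)) ⟨
  just (x (suc p * m))            ≡⟨ cong (just ∘ x ∘ suc) (+-comm l (p * m)) ⟩
  just (x (suc (p * m + l)))      ∎
  where
  open ≡-Reasoning
  l = List⁺.length W
  m = suc l
  w = List⁺.toList W

-- The bound on `i` is the length of the iterate. Letter `i` of the next iterate lies in the block
-- of letter `i / m`, which the induction hypothesis covers.
‼-σ^ : ∀ (W : List⁺ A) {x} → Blocks W x → List⁺.head W ≡ x 1 →
       ∀ k {i} → i < suc (List⁺.length W) ^ k → σ^ W k [ List⁺.head W ] ‼ i ≡ just (x (suc i))
‼-σ^ W     blocks h≡ zero    {zero}  _ = cong just h≡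
‼-σ^ W     blocks h≡ zero    {suc i} (s<s ())
‼-σ^ W {x} blocks h≡ (suc k) {i}     i<mᵏ⁺¹ = begin
  σ W u ‼ i                             ≡⟨ cong (σ W u ‼_) i≡ ⟩
  σ W u ‼ (p * m + r)                   ≡⟨ ‼-σ W u {p} (‼-σ^ W {x} blocks h≡ k p<mᵏ) (m%n<n i m) ⟩
  (List⁺.toList W ++ [ x (suc p) ]) ‼ r ≡⟨ blocks p (m%n<n i m) ⟩
  just (x (suc (p * m + r)))            ≡⟨ cong (just ∘ x ∘ suc) i≡ ⟨
  just (x (suc i))                      ∎
  where
  open ≡-Reasoning
  m = suc (List⁺.length W)
  u = σ^ W k [ List⁺.head W ]
  p = i / m
  r = i % m
  i≡ : i ≡ p * m + r
  i≡ = trans (m≡m%n+[m/n]*n i m) (+-comm r _)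
  p<mᵏ : p < m ^ k
  p<mᵏ = m<n*o⇒m/o<n (subst (i <_) (*-comm m (m ^ k)) i<mᵏ⁺¹)

n<m^n : ∀ {m} → 2 ≤ m → ∀ n → n < m ^ n
n<m^n     2≤m zero    = z<s
n<m^n {m} 2≤m (suc n) = begin-strict
  suc n       ≤⟨ n<m^n 2≤m n ⟩
  m ^ n       <⟨ m<m*n (m ^ n) m {{>-nonZero (≤-<-trans z≤n (n<m^n 2≤m n))}} 2≤m ⟩
  m ^ n * m   ≡⟨ *-comm (m ^ n) m ⟩
  m * m ^ n   ∎
  where open ≤-Reasoning

isToeplitz⇔ : ∀ {m} → 2 ≤ m → (X : InfWord A) (x : ℕ → A) →
              (∀ j .{{_ : NonZero j}} → X j ≡ x j) →
              IsToeplitzFixedPoint m X ⇔ Toeplitz m x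
isToeplitz⇔ {A = A} {m} 2≤m X x X≡x = mk⇔ to (from 2≤m)
  where
  agrees : ∀ n u → take n u ≡ toList (prefix n X) ⇔ (∀ {i} → i < n → u ‼ i ≡ just (X (suc i)))
  agrees n = take≡tabulate⇔ n (λ i → X (suc i))

  to : IsToeplitzFixedPoint m X → Toeplitz m x
  to (W , |W|≡ , conv) =
    subst (λ m → Toeplitz m x) (trans (cong suc |W|≡) (m+[n∸m]≡n (<⇒≤ 2≤m))) (blocks⇒toeplitz W blocks)
    where
    open ≡-Reasoning
    blocks : Blocks W x
    blocks p {i} i<l = begin
      -- Two consecutive iterates are compared with `x`: the `K`-th at `p`, and its image under `σ`
      -- inside block `p`. The prefix length `n` covers both indices.
      (List⁺.toList W ++ [ x (suc p) ]) ‼ i   ≡⟨ ‼-σ W u {p} (agree ≤-refl p<n) i<l ⟨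
      σ W u ‼ (p * l + i)                     ≡⟨ agree (n≤1+n K) (n<1+n (p * l + i)) ⟩
      just (x (suc (p * l + i)))              ∎
      where
      l = suc (List⁺.length W)
      n = suc (p * l + i)
      K = proj₁ (conv n)
      u = σ^ W K [ List⁺.head W ]
      agree : ∀ {k j} → K ≤ k → j < n → σ^ W k [ List⁺.head W ] ‼ j ≡ just (x (suc j))
      agree {k} {j} K≤k j<n =
        trans (Equivalence.to (agrees n _) (proj₂ (conv n) k K≤k) j<n) (cong just (X≡x (suc j)))
      p<n : p < n
      p<n = s≤s (≤-trans (m≤m*n p l) (m≤m+n (p * l) i))

  from : ∀ {m} → 2 ≤ m → Toeplitz m x → IsToeplitzFixedPoint m X
  from {suc zero}    (s≤s ())
  from {suc (suc l)} 2≤m t = W , |W|≡ , conv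
    where
    W : List⁺ A
    -- The first `m - 1` letters of `x`, with the head split off; `m ≥ 2` makes this word nonempty.
    W = x 1 ∷ applyUpTo (λ i → x (suc (suc i))) l
    |W|≡ : List⁺.length W ≡ suc l
    |W|≡ = length-applyUpTo (x ∘ suc) (suc l)
    blocks : Blocks W x
    blocks = toeplitz⇒blocks W (cong (applyUpTo (x ∘ suc)) (sym |W|≡))
                               (subst (λ m → Toeplitz m x) (cong suc (sym |W|≡)) t)
    conv : (λ k → σ^ W k [ List⁺.head W ]) ⟶ X
    -- `K = n` is large enough because `n < m ^ n`.
    conv n = n , λ k n≤k → Equivalence.from (agrees n _) λ {i} i<n →
      trans (‼-σ^ W {x} blocks refl k (subst (λ l → i < suc l ^ k) (sym |W|≡)
                                    (<-trans i<n (≤-<-trans n≤k (n<m^n 2≤m k)))))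
            (cong just (sym (X≡x (suc i))))

-- From words on positive positions to total sequences, and the theorem.

-- The value at the non-position 0 is junk.
total : InfWord A → ℕ → A
total X zero    = X 1
total X (suc j) = X (suc j)

total≡ : ∀ (X : InfWord A) j .{{_ : NonZero j}} → X j ≡ total X j
total≡ X (suc j) = refl

-- The modulus `M` is kept general to serve both `m` and `m ^ 2`. Given `q ∣ M`, the condition
-- `M ∤ q` supplies the strict bound `q < M` in the finite notion.
prefix-almostPeriodic⇔ :
  ∀ {M q} .{{_ : NonZero M}} .{{_ : NonZero q}} (X : InfWord A) → Toeplitz M (total X) →
  2 ≤ q → q ∣ M → ¬ M ∣ q →
  AlmostPeriodic∞ q (total X) ⇔ AlmostPeriodic q (prefix M X)
prefix-almostPeriodic⇔ {M = M} {q} X t 2≤q q∣M M∤q = mk⇔ to from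
  where
  entry : ∀ i → lookup (prefix M X) i ≡ X (suc (toℕ i))
  entry = lookup∘tabulate (λ i → X (suc (toℕ i)))

  to : AlmostPeriodic∞ q (total X) → AlmostPeriodic q (prefix M X)
  to ap = 2≤q , ≤∧≢⇒< (∣⇒≤ q∣M) (λ { refl → M∤q ∣-refl }) , λ i i′ i′≡ q∤i → begin
    lookup (prefix M X) i          ≡⟨ entry i ⟩
    total X (suc (toℕ i))          ≡⟨ ap (suc (toℕ i)) q∤i ⟨
    total X (suc (toℕ i + q))      ≡⟨ cong (total X ∘ suc) i′≡ ⟨
    total X (suc (toℕ i′))         ≡⟨ entry i′ ⟨
    lookup (prefix M X) i′         ∎
    where open ≡-Reasoning

  from : AlmostPeriodic q (prefix M X) → AlmostPeriodic∞ q (total X)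
  from (_ , _ , ap) = extend-almostPeriodic (almostPeriodic t) q∣M fin
    where
    open ≡-Reasoning
    fin : ∀ n → n + q ≤ M → ¬ q ∣ n → total X (n + q) ≡ total X n
    fin zero    _  q∤n = contradiction (q ∣0) q∤n
    fin (suc n) n+q<M q∤n = begin
      total X (suc (n + q))        ≡⟨ cong (total X ∘ suc) (toℕ-fromℕ< n+q<M) ⟨
      total X (suc (toℕ i′))       ≡⟨ entry i′ ⟨
      lookup (prefix M X) i′       ≡⟨ ap i i′ i′≡ (subst (λ k → ¬ q ∣ suc k) (sym i≡) q∤n) ⟨
      lookup (prefix M X) i        ≡⟨ entry i ⟩
      total X (suc (toℕ i))        ≡⟨ cong (total X ∘ suc) i≡ ⟩
      total X (suc n)              ∎
      where
      n<M = ≤-<-trans (m≤m+n n q) n+q<M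
      i  = fromℕ< n<M
      i′ = fromℕ< n+q<M
      i≡ : toℕ i ≡ n
      i≡ = toℕ-fromℕ< n<M
      i′≡ : toℕ i′ ≡ toℕ i + q
      i′≡ = trans (toℕ-fromℕ< n+q<M) (cong (_+ q) (sym i≡))

theorem1p1 : ∀ {a : Level} {A : Set a} → Finite A →
    (m : ℕ) → 2 ≤ m →
    (X : InfWord A) → IsToeplitzFixedPoint m X → ¬ Constant X →
    (q : ℕ) .{{_ : NonZero q}} → 2 ≤ q →
    ¬ (m ∣ q) → ∃[ s ] (1 ≤ s × q ∣ m ^ s) →
    (¬ (q ∣ m ^ 2) → ¬ IsToeplitzFixedPoint m (multiples q X))
    × (q ∣ m → (IsToeplitzFixedPoint m (multiples q X) ⇔ AlmostPeriodic q (prefix m X)))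
    × (q ∣ m ^ 2 → (IsToeplitzFixedPoint m (multiples q X) ⇔ AlmostPeriodic q (prefix (m ^ 2) X)))
theorem1p1 _ m@(suc _) 2≤m X toepX nonconst q 2≤q m∤q (s , _ , q∣mˢ) =
    (λ q∤m² toepY → nonconst (x q , λ j → trans (total≡ X j)
      (constant-of-multiples m≡dg q≡eg e⊥d t m∤q s q∣mˢ (toY toepY) 2≤m
        (q∤m² ∘ subst (q ∣_) (sym m²≡)) j)))
  , (λ q∣m → prefix-almostPeriodic⇔ X t 2≤q q∣m m∤q ⇔-∘ Y⇔)
  , (λ q∣m² → prefix-almostPeriodic⇔ X t² 2≤q q∣m² (m∤q ∘ m*n∣⇒m∣ m (m ^ 1)) ⇔-∘ Y⇔)
  where
  x = total X
  t : Toeplitz m x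
  t = Equivalence.to (isToeplitz⇔ 2≤m X x (total≡ X)) toepX

  m²≡ : m ^ 2 ≡ m * m
  m²≡ = cong (m *_) (*-identityʳ m)
  t² : Toeplitz (m ^ 2) x
  t² = subst (λ M → Toeplitz M x) (sym m²≡) (toeplitz-square t)

  g = gcd m q
  instance
    m²≢0 : NonZero (m ^ 2)
    m²≢0 = m^n≢0 m 2
    g≢0 : NonZero g
    g≢0 = ≢-nonZero (gcd[m,n]≢0 m q (inj₁ λ ()))
    d≢0 : NonZero (m / g)
    d≢0 = >-nonZero (m≥n⇒m/n>0 (∣⇒≤ (gcd[m,n]∣m m q)))
  m≡dg : m ≡ m / g * g
  m≡dg = sym (m/n*n≡m (gcd[m,n]∣m m q))
  q≡eg : q ≡ q / g * g
  q≡eg = sym (m/n*n≡m (gcd[m,n]∣n m q))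
  e⊥d : Coprime (q / g) (m / g)
  e⊥d = Coprimality.sym (coprime-/gcd m q)

  isToeplitzY⇔ : IsToeplitzFixedPoint m (multiples q X) ⇔ Toeplitz m (λ j → x (q * j))
  isToeplitzY⇔ = isToeplitz⇔ 2≤m (multiples q X) _ (λ j → total≡ X (q * j) {{m*n≢0 q j}})

  toY : IsToeplitzFixedPoint m (multiples q X) → AlmostPeriodic∞ m (λ j → x (q * j))
  toY = almostPeriodic ∘ Equivalence.to isToeplitzY⇔

  -- Common to (ii) and (iii), which differ only in the length of the prefix on which almost
  -- `q`-periodicity is tested.
  Y⇔ : IsToeplitzFixedPoint m (multiples q X) ⇔ AlmostPeriodic∞ q x
  Y⇔ = mk⇔ (almostPeriodic-of-multiples m≡dg q≡eg e⊥d t m∤q s q∣mˢ ∘ toY)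
    λ apq → Equivalence.from isToeplitzY⇔ record
      { almostPeriodic = multiples-almostPeriodic t apq
      ; selfSimilar    = λ j → trans (cong x (swapˡ q m j)) (selfSimilar t (q * j))
      }
    where
    swapˡ : ∀ q m j → q * (m * j) ≡ m * (q * j)
    swapˡ = solve-∀
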